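{- Let $N(X,Y,Z)$ be a combinational circuit with input variables $X$, internal variables $Y$ and output variables $Z$, and let $F(X,Y,Z)$ be the CNF formula specifying the functionality of $N$. Let $G\subseteq F$ be a set of clauses of $F$, let $F' = F\setminus G$ (so $F = G\wedge F'$), let $G^*$ be a set of clauses over variables in $X\cup Y\cup Z$, and let $F^* = G^*\wedge F'$. Put $T_{\mathrm{tbl}}(X,Z) = \exists Y[F]$ and $T^*_{\mathrm{tbl}}(X,Z) = \exists Y[F^*]$. Assume that for every assignment $\vec{x}$ to $X$ there is exactly one assignment $\vec{z}$ to $Z$ with $T^*_{\mathrm{tbl}}(\vec{x},\vec{z}) = 1$. Let $Q(X,Z)$ be a formula that is a solution to the problem of taking $G^*$ out of the scope of quantifiers in $\exists Y[G^*\wedge F']$, i.e. $\exists Y[G^*\wedge F'] \equiv Q\wedge \exists Y[F']$. Then $$F\not\Rightarrow Q \quad\text{if and only if}\quad T_{\mathrm{tbl}}\not\equiv T^*_{\mathrm{tbl}}.$$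
   Context: All formulas are propositional and quantifiers range over Boolean assignments. A clause is a disjunction of literals; a CNF formula is a conjunction of clauses and is identified with its set of clauses (so $F\setminus G$ denotes the conjunction of the clauses of $F$ not in $G$). $\exists Y[H]$ denotes $H$ with the variables of $Y$ existentially quantified, a predicate of the remaining variables. $A\Rightarrow B$ means that every assignment satisfying $A$ satisfies $B$; $A\equiv B$ denotes logical equivalence. The sets $X,Y,Z$ are finite and pairwise disjoint. A combinational circuit $N(X,Y,Z)$ consists of gates $g_1,\dots,g_m$ (connected acyclically), each gate computing the value of one variable of $Y\cup Z$ as a Boolean function of other variables, with every variable of $Y\cup Z$ being the output of exactly one gate. The formula $F$ specifying $N$ is $G_1\wedge\dots\wedge G_m$, where $G_i$ is a CNF formula whose satisfying assignments are exactly the assignments to the input and output variables of $g_i$ that are consistent with the function of $g_i$. In particular, for every assignment $\vec{x}$ to $X$ there is exactly one pair of assignments $(\vec{y},\vec{z})$ to $Y$ and $Z$ (the execution trace of $N$ under $\vec{x}$) such that $F(\vec{x},\vec{y},\vec{z})=1$. Partial quantifier elimination (PQE): for formulas $H_1(V,W), H_2(V,W)$, a solution to the problem of taking $H_1$ out of the scope of quantifiers in $\exists V[H_1\wedge H_2]$ is a formula $H_1^*(W)$ with $\exists V[H_1\wedge H_2]\equiv H_1^*\wedge\exists V[H_2]$. -}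

module Defs where

open import Data.Bool using (Bool; true; false; not; _∧_; _∨_)
open import Data.Fin using (Fin)
open import Data.Fin.Properties using () renaming (_≟_ to _≟ᶠ_)
open import Data.List using (List; []; _∷_; foldr; map; filter; concat; tabulate)
open import Data.List.Membership.Propositional using (_∈_)
import Data.List.Membership.DecPropositional as DecMembership
import Data.List.Properties as List
open import Data.List.Relation.Unary.All using (All)
open import Data.Nat using (ℕ)
open import Data.Product using (_×_; ∃; ∃!)
open import Data.Sum using (_⊎_; inj₁; inj₂; [_,_]′)
import Data.Sum.Properties as Sum
open import Data.Vec as Vec using (Vec; toList)
open import Function using (_∘_)
open import Level using (0ℓ)
open import Relation.Binary using (DecidableEquality; Rel)
open import Relation.Binary.Construct.Closure.Transitive using (TransClosure)
open import Relation.Binary.PropositionalEquality using (_≡_; refl; cong)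
open import Relation.Nullary using (¬_; no)
open import Relation.Nullary.Decidable using (map′)
open import Relation.Unary using (Pred; _⊆_; _≐_; _∩_; _⊢_)

private
  variable
    V W : Set

Assignment : Set → Set
Assignment V = V → Bool

infixr 7 _∧ᶠ_
infixr 6 _∨ᶠ_

data Formula (V : Set) : Set where
  var       : V → Formula V
  ⊤ᶠ ⊥ᶠ     : Formula V
  ¬ᶠ_       : Formula V → Formula V
  _∧ᶠ_ _∨ᶠ_ : Formula V → Formula V → Formula V

eval : Formula V → Assignment V → Bool
eval (var v)  a = a v
eval ⊤ᶠ       a = true
eval ⊥ᶠ       a = false
eval (¬ᶠ φ)   a = not (eval φ a)
eval (φ ∧ᶠ ψ) a = eval φ a ∧ eval ψ a
eval (φ ∨ᶠ ψ) a = eval φ a ∨ eval ψ a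

Models : Formula V → Pred (Assignment V) 0ℓ
Models φ a = eval φ a ≡ true

data Literal (V : Set) : Set where
  pos neg : V → Literal V

variable-of : Literal V → V
variable-of (pos v) = v
variable-of (neg v) = v

Clause : Set → Set
Clause V = List (Literal V)

-- A finite set of clauses, listed: only membership matters for inclusion,
-- difference and models.  Clauses themselves are compared as written, so
-- reordering the literals of a clause gives a different clause.
CNF : Set → Set
CNF V = List (Clause V)

literalFormula : Literal V → Formula V
literalFormula (pos v) = var v
literalFormula (neg v) = ¬ᶠ var v

clauseFormula : Clause V → Formula V
clauseFormula = foldr _∨ᶠ_ ⊥ᶠ ∘ map literalFormula

⌜_⌝ : CNF V → Formula V
⌜_⌝ = foldr _∧ᶠ_ ⊤ᶠ ∘ map clauseFormula

literal-≟ : DecidableEquality V → DecidableEquality (Literal V)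
literal-≟ _≟_ (pos u) (pos v) = map′ (cong pos) (λ { refl → refl }) (u ≟ v)
literal-≟ _≟_ (neg u) (neg v) = map′ (cong neg) (λ { refl → refl }) (u ≟ v)
literal-≟ _≟_ (pos _) (neg _) = no λ ()
literal-≟ _≟_ (neg _) (pos _) = no λ ()

module Difference (_≟_ : DecidableEquality V) where
  open DecMembership (List.≡-dec (literal-≟ _≟_)) using (_∉?_)

  infixl 6 _∖_
  _∖_ : CNF V → CNF V → CNF V
  F ∖ G = filter (_∉? G) F

-- Variables V ⊎ W are the disjoint union of the quantified variables V and
-- the free variables W.

∃ˡ : Formula (V ⊎ W) → Pred (Assignment W) 0ℓ
∃ˡ H w = ∃ λ v → Models H [ v , w ]′

infix 4 _⇒_
_⇒_ : Formula (V ⊎ W) → Formula W → Set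
A ⇒ B = Models A ⊆ ((_∘ inj₂) ⊢ Models B)

IsPQESolution : (H₁ H₂ : Formula (V ⊎ W)) → Formula W → Set
IsPQESolution H₁ H₂ H₁* = ∃ˡ (H₁ ∧ᶠ H₂) ≐ (Models H₁* ∩ ∃ˡ H₂)

-- Circuit variables: nx inputs (X), ny internal variables (Y), nz outputs (Z).
-- Y comes first because it is the quantified block.

Var : (nx ny nz : ℕ) → Set
Var nx ny nz = Fin ny ⊎ (Fin nx ⊎ Fin nz)

var-≟ : ∀ {nx ny nz} → DecidableEquality (Var nx ny nz)
var-≟ = Sum.≡-dec _≟ᶠ_ (Sum.≡-dec _≟ᶠ_ _≟ᶠ_)

module _ {nx ny nz : ℕ} where
  open Difference (var-≟ {nx} {ny} {nz}) public

record Gate (nx ny nz : ℕ) : Set where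
  field
    {arity}  : ℕ
    inputs   : Vec (Var nx ny nz) arity
    function : Vec Bool arity → Bool
    target   : Fin ny ⊎ Fin nz

  output : Var nx ny nz
  output = [ inj₁ , inj₂ ∘ inj₂ ]′ target

  Consistent : Pred (Assignment (Var nx ny nz)) 0ℓ
  Consistent a = a output ≡ function (Vec.map a inputs)

record Circuit (nx ny nz : ℕ) : Set where
  field
    {size} : ℕ
    gate   : Fin size → Gate nx ny nz

  open module G i = Gate (gate i) using (inputs; target; output; Consistent) public

  _feeds_ : Rel (Fin size) 0ℓ
  i feeds j = output i ∈ toList (inputs j)

  field
    uniqueDriver : ∀ u → ∃! _≡_ λ i → target i ≡ u
    acyclic      : ∀ i → ¬ TransClosure _feeds_ i i

record GateCNFs {nx ny nz} (N : Circuit nx ny nz) : Set where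
  open Circuit N
  field
    cnf    : Fin size → CNF (Var nx ny nz)
    scope  : ∀ i → All (All λ l → variable-of l ∈ output i ∷ toList (inputs i)) (cnf i)
    models : ∀ i → Models ⌜ cnf i ⌝ ≐ Consistent i

  specification : CNF (Var nx ny nz)
  specification = concat (tabulate cnf)

{-# OPTIONS --safe #-}
module Submission where

-- If F ⇒ Q, then T ⊆ T*: a model of F satisfies F′ and Q, so the PQE identity
-- puts it in T*.  Conversely, under any input x the circuit has an execution
-- trace, whose output satisfies T and hence T*; since T* allows only one output
-- per input, T* ⊆ T.  That T ≐ T* gives F ⇒ Q is immediate from the PQE identity.

open import Defs
open import Data.Bool using (Bool; true; not; _∧_; _∨_)
open import Data.Fin using (Fin)
open import Data.Fin.Induction using (spo-wellFounded)
open import Data.List using ([]; _∷_)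
open import Data.List.Membership.Propositional using (_∈_)
import Data.List.Membership.DecPropositional as DecMembership
import Data.List.Properties as List
open import Data.List.Relation.Binary.Subset.Propositional using (_⊆_)
open import Data.List.Relation.Unary.All using (All; []; _∷_)
open import Data.List.Relation.Unary.All.Properties using (concat⁺; tabulate⁺; filter⁺)
open import Data.Nat using (ℕ)
open import Data.Product using (∃; ∃!; _,_; _×_; proj₁; proj₂)
open import Data.Sum using (_⊎_; inj₁; inj₂; [_,_]′)
open import Data.Vec as Vec using (lookup; tabulate; toList)
open import Data.Vec.Membership.Propositional.Properties using (∈-lookup; ∈-toList⁺)
open import Data.Vec.Properties using (tabulate-cong; tabulate-∘; tabulate∘lookup)
open import Function using (_⇔_; mk⇔; _∘_)
open import Induction.WellFounded using (WellFounded; module All; module FixPoint)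
open import Level using (0ℓ)
open import Relation.Binary using (Rel; IsStrictPartialOrder)
open import Relation.Binary.Construct.Closure.Transitive using (TransClosure; [_]; _++_)
open import Relation.Binary.PropositionalEquality
  using (_≡_; _≗_; refl; sym; trans; cong; cong₂; subst; resp₂; isEquivalence; module ≡-Reasoning)
open import Relation.Nullary using (¬_; contraposition)
open import Relation.Unary using (_≐_)

private
  variable
    V W : Set

-- Assignments are functions, and reassembling one from its blocks with `[_,_]′` gives back only a
-- pointwise equal function. Hence truth has to be transported along `≗`.
eval-cong : (φ : Formula V) {a b : Assignment V} → a ≗ b → eval φ a ≡ eval φ b
eval-cong (var v)  a≗b = a≗b v
eval-cong ⊤ᶠ       a≗b = refl
eval-cong ⊥ᶠ       a≗b = refl
eval-cong (¬ᶠ φ)   a≗b = cong not (eval-cong φ a≗b)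
eval-cong (φ ∧ᶠ ψ) a≗b = cong₂ _∧_ (eval-cong φ a≗b) (eval-cong ψ a≗b)
eval-cong (φ ∨ᶠ ψ) a≗b = cong₂ _∨_ (eval-cong φ a≗b) (eval-cong ψ a≗b)

Models-resp : (φ : Formula V) {a b : Assignment V} → a ≗ b → Models φ a → Models φ b
Models-resp φ a≗b = trans (sym (eval-cong φ a≗b))

∃ˡ-resp : (H : Formula (V ⊎ W)) {w w′ : Assignment W} → w ≗ w′ → ∃ˡ H w → ∃ˡ H w′
∃ˡ-resp H w≗w′ (v , h) = v , Models-resp H (λ { (inj₁ _) → refl ; (inj₂ u) → w≗w′ u }) h

∃ˡ-intro : (H : Formula (V ⊎ W)) {a : Assignment (V ⊎ W)} → Models H a → ∃ˡ H (a ∘ inj₂)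
∃ˡ-intro H {a} h = a ∘ inj₁ , Models-resp H (λ { (inj₁ _) → refl ; (inj₂ _) → refl }) h

Models-∧⁺ : (φ ψ : Formula V) {a : Assignment V} → Models φ a → Models ψ a → Models (φ ∧ᶠ ψ) a
Models-∧⁺ φ ψ = cong₂ _∧_

Models-∧⁻ : (φ ψ : Formula V) {a : Assignment V} → Models (φ ∧ᶠ ψ) a → Models φ a × Models ψ a
Models-∧⁻ φ ψ {a} h with eval φ a | eval ψ a
Models-∧⁻ φ ψ refl | true | true = refl , refl

Models-⌜⌝⁺ : {F : CNF V} {a : Assignment V} → All (λ C → Models (clauseFormula C) a) F → Models ⌜ F ⌝ a
Models-⌜⌝⁺ []                     = refl
Models-⌜⌝⁺ {F = C ∷ F} (h ∷ hs) = Models-∧⁺ (clauseFormula C) ⌜ F ⌝ h (Models-⌜⌝⁺ hs)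

Models-⌜⌝⁻ : (F : CNF V) {a : Assignment V} → Models ⌜ F ⌝ a → All (λ C → Models (clauseFormula C) a) F
Models-⌜⌝⁻ []      _ = []
Models-⌜⌝⁻ (C ∷ F) h with hC , hF ← Models-∧⁻ (clauseFormula C) ⌜ F ⌝ h = hC ∷ Models-⌜⌝⁻ F hF

Models-∖ : ∀ {nx ny nz} (F G : CNF (Var nx ny nz)) {a} → Models ⌜ F ⌝ a → Models ⌜ F ∖ G ⌝ a
Models-∖ F G h = Models-⌜⌝⁺ (filter⁺ (_∉? G) (Models-⌜⌝⁻ F h))
  where open DecMembership (List.≡-dec (literal-≟ var-≟)) using (_∉?_)

-- Acyclicity is irreflexivity of the transitive closure, which is thus a strict partial order, and
-- on a finite set every such order is well-founded.
acyclic⇒wellFounded : ∀ {n} {_⟶_ : Rel (Fin n) 0ℓ} →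
                      (∀ i → ¬ TransClosure _⟶_ i i) → WellFounded (TransClosure _⟶_)
acyclic⇒wellFounded {_⟶_ = _⟶_} acyclic = spo-wellFounded isStrictPartialOrder
  where
  isStrictPartialOrder : IsStrictPartialOrder _≡_ (TransClosure _⟶_)
  isStrictPartialOrder = record
    { isEquivalence = isEquivalence
    ; irrefl        = λ { refl → acyclic _ }
    ; trans         = _++_
    ; <-resp-≈      = resp₂ _
    }

module Execution {nx ny nz} (N : Circuit nx ny nz) (x : Assignment (Fin nx)) where
  open Circuit N
  open module GateOf i = Gate (gate i) using (function)

  private
    _feeds⁺_ : Rel (Fin size) 0ℓ
    _feeds⁺_ = TransClosure _feeds_

    feeds⁺-wellFounded : WellFounded _feeds⁺_
    feeds⁺-wellFounded = acyclic⇒wellFounded acyclic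

  driver : Fin ny ⊎ Fin nz → Fin size
  driver u = proj₁ (uniqueDriver u)

  output-driver : ∀ u → output (driver u) ≡ [ inj₁ , inj₂ ∘ inj₂ ]′ u
  output-driver u = cong [ inj₁ , inj₂ ∘ inj₂ ]′ (proj₁ (proj₂ (uniqueDriver u)))

  driver-target : ∀ i → driver (target i) ≡ i
  driver-target i = proj₂ (proj₂ (uniqueDriver (target i))) refl

  -- The callback also receives the proof that gate `j` drives `v`. `evalGate` turns it into
  -- `j feeds⁺ i`, which licenses the recursive call; `trace` ignores it.
  read : ∀ v → (∀ j → output j ≡ v → Bool) → Bool
  read (inj₁ y)        val = val (driver (inj₁ y)) (output-driver (inj₁ y))
  read (inj₂ (inj₁ i)) val = x i
  read (inj₂ (inj₂ z)) val = val (driver (inj₂ z)) (output-driver (inj₂ z))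

  read-cong : ∀ v {val val′} → (∀ j e → val j e ≡ val′ j e) → read v val ≡ read v val′
  read-cong (inj₁ y)        eq = eq _ _
  read-cong (inj₂ (inj₁ _)) eq = refl
  read-cong (inj₂ (inj₂ z)) eq = eq _ _

  driver-feeds : ∀ i k j → output j ≡ lookup (inputs i) k → j feeds⁺ i
  driver-feeds i k j e = [ subst (_∈ toList (inputs i)) (sym e) (∈-toList⁺ (∈-lookup k (inputs i))) ]

  evalGate : ∀ i → (∀ {j} → j feeds⁺ i → Bool) → Bool
  evalGate i val = function i (tabulate λ k → read (lookup (inputs i) k) λ j e → val (driver-feeds i k j e))

  -- Extensionality of the recursion step, the condition under which well-founded recursion
  -- satisfies its unfolding equation.
  evalGate-cong : ∀ i {val val′ : ∀ {j} → j feeds⁺ i → Bool} →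
                  (∀ {j} (p : j feeds⁺ i) → val p ≡ val′ p) → evalGate i val ≡ evalGate i val′
  evalGate-cong i eq = cong (function i) (tabulate-cong λ k → read-cong (lookup (inputs i) k) λ _ _ → eq _)

  value : Fin size → Bool
  value = All.wfRec feeds⁺-wellFounded _ (λ _ → Bool) evalGate

  value-unfold : ∀ i → value i ≡ evalGate i (λ {j} _ → value j)
  value-unfold i = FixPoint.unfold-wfRec feeds⁺-wellFounded (λ _ → Bool) evalGate evalGate-cong

  trace : Assignment (Var nx ny nz)
  trace v = read v λ j _ → value j

  trace-output : ∀ i → trace (output i) ≡ value i
  trace-output i = trans (trace-target (target i)) (cong value (driver-target i))
    where
    -- `read` reduces only once the target is known to lie in Y or in Z.
    trace-target : ∀ u → trace ([ inj₁ , inj₂ ∘ inj₂ ]′ u) ≡ value (driver u)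
    trace-target (inj₁ _) = refl
    trace-target (inj₂ _) = refl

  trace-consistent : ∀ i → Consistent i trace
  trace-consistent i = begin
    trace (output i)                                     ≡⟨ trace-output i ⟩
    -- In the unfolded `evalGate i`, each input is read exactly as `trace` reads it, so the next
    -- line holds by definition.
    value i                                              ≡⟨ value-unfold i ⟩
    function i (tabulate (trace ∘ lookup (inputs i)))    ≡⟨ cong (function i) (tabulate-∘ trace (lookup (inputs i))) ⟩
    function i (Vec.map trace (tabulate (lookup (inputs i))))
      ≡⟨ cong (function i ∘ Vec.map trace) (tabulate∘lookup (inputs i)) ⟩
    function i (Vec.map trace (inputs i))                ∎
    where open ≡-Reasoning

  -- The specification concatenates the gate CNFs, so it can be checked clause by clause, gate by
  -- gate.
  trace-models : (Gs : GateCNFs N) → Models ⌜ GateCNFs.specification Gs ⌝ trace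
  trace-models Gs = Models-⌜⌝⁺ (concat⁺ (tabulate⁺ λ i → Models-⌜⌝⁻ (cnf i) (proj₂ (models i) (trace-consistent i))))
    where open GateCNFs Gs

  output-exists : (Gs : GateCNFs N) → ∃ λ z → ∃ˡ ⌜ GateCNFs.specification Gs ⌝ [ x , z ]′
  output-exists Gs = trace ∘ inj₂ ∘ inj₂ ,
    ∃ˡ-resp F (λ { (inj₁ _) → refl ; (inj₂ _) → refl }) (∃ˡ-intro F (trace-models Gs))
    where F = ⌜ GateCNFs.specification Gs ⌝

proposition2 :
    ∀ {nx ny nz : ℕ} (N : Circuit nx ny nz) (Gs : GateCNFs N) →
    let F = GateCNFs.specification Gs in
    (G : CNF (Var nx ny nz)) → G ⊆ F →
    (G* : CNF (Var nx ny nz)) →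
    let F′ = F ∖ G
        F* = ⌜ G* ⌝ ∧ᶠ ⌜ F′ ⌝
        Ttbl  = ∃ˡ ⌜ F ⌝
        Ttbl* = ∃ˡ F* in
    (∀ (x : Assignment (Fin nx)) → ∃! _≗_ λ (z : Assignment (Fin nz)) → Ttbl* [ x , z ]′) →
    (Q : Formula (Fin nx ⊎ Fin nz)) →
    IsPQESolution ⌜ G* ⌝ ⌜ F′ ⌝ Q →
    (¬ (⌜ F ⌝ ⇒ Q)) ⇔ (¬ (Ttbl ≐ Ttbl*))
proposition2 {nx} {ny} {nz} N Gs G _ G* functional Q (pqe⇒ , pqe⇐) =
  -- Each direction is the contrapositive of one half of the equivalence between `⌜ F ⌝ ⇒ Q` and
  -- equality of the tables, so the argument stays constructive.
  mk⇔ (contraposition equal⇒implied) (contraposition implied⇒equal)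
  where
  F = GateCNFs.specification Gs
  F′ = F ∖ G
  F* = ⌜ G* ⌝ ∧ᶠ ⌜ F′ ⌝

  equal⇒implied : ∃ˡ ⌜ F ⌝ ≐ ∃ˡ F* → ⌜ F ⌝ ⇒ Q
  equal⇒implied (T⊆T* , _) h = proj₁ (pqe⇒ (T⊆T* (∃ˡ-intro ⌜ F ⌝ h)))

  implied⇒equal : ⌜ F ⌝ ⇒ Q → ∃ˡ ⌜ F ⌝ ≐ ∃ˡ F*
  implied⇒equal F⇒Q = T⊆T* , T*⊆T
    where
    T⊆T* : ∀ {w} → ∃ˡ ⌜ F ⌝ w → ∃ˡ F* w
    -- The same `y` witnesses `∃ˡ ⌜ F′ ⌝`, since removing clauses preserves models.
    T⊆T* (y , h) = pqe⇐ (F⇒Q h , y , Models-∖ F G h)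

    T*⊆T : ∀ {w} → ∃ˡ F* w → ∃ˡ ⌜ F ⌝ w
    T*⊆T {w} t* =
      let x = w ∘ inj₁
          z , t = Execution.output-exists N x Gs
          _ , _ , unique = functional x
          -- The Z-part of `w` and the circuit's output `z` both equal the only output that `F*`
          -- allows under `x`, hence agree pointwise, and `t` carries over from `z` to `w`.
          w-output = unique (∃ˡ-resp F* (λ { (inj₁ _) → refl ; (inj₂ _) → refl }) t*)
          z-output = unique (T⊆T* t)
      in ∃ˡ-resp ⌜ F ⌝ (λ { (inj₁ _) → refl ; (inj₂ i) → trans (sym (z-output i)) (w-output i) }) t
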